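{- Let $G=(V,E)$ be a finite directed acyclic graph. Then, with the minimum taken over all weak dominance drawings $\Gamma$ of $G$, $$\min_{\Gamma} fip(\Gamma)\ \le\ inc(G)-(dim(G)-2).$$
   Context: Let $G=(V,E)$ be a finite directed acyclic graph (dag). A topological sorting of $G$ is a bijection $t:V\to\{1,\dots,|V|\}$ such that $t(u)<t(v)$ for every edge $(u,v)\in E$. Weak dominance drawing: a (two-dimensional) weak dominance drawing $\Gamma$ of $G$ assigns to each vertex $u$ coordinates $(X(u),Y(u))$, where $X=t_X$ and $Y=t_Y$ are two (not necessarily distinct) topological sortings of $G$; in particular, if there is a directed path from $u$ to $v$ in $G$ then $X(u)\le X(v)$ and $Y(u)\le Y(v)$. Falsely implied paths: a falsely implied path (fip) of $\Gamma$ is an ordered pair $(u,v)$ of distinct vertices such that $X(u)\le X(v)$ and $Y(u)\le Y(v)$ but there is no directed path from $u$ to $v$ in $G$. The number of falsely implied paths of $\Gamma$ is denoted $fip(\Gamma)$. Incomparable pairs: $inc(G)$ is the number of unordered pairs $\{u,v\}$ of distinct vertices such that neither is reachable from the other by a directed path. Dimension: $dim(G)$ is the dominance drawing dimension of $G$, i.e. the smallest $k\ge 1$ for which a $k$-dimensional dominance drawing of $G$ exists; equivalently, the smallest $k\ge 1$ for which there are topological sortings $t_1,\dots,t_k$ of $G$ such that for all distinct $u,v\in V$ there is a directed path from $u$ to $v$ in $G$ if and only if $t_i(u)<t_i(v)$ for all $i=1,\dots,k$. -}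

module Defs where

open import Data.Fin using (Fin; _≤_; _<_; _≤?_; _<?_; _≟_)
open import Data.Fin.Induction using (spo-noetherian)
open import Data.Fin.Properties using (any?)
open import Data.List using (length; filter; cartesianProduct; allFin)
open import Data.Nat as ℕ using (ℕ)
open import Data.Product using (_×_; _,_; proj₁; proj₂; ∃-syntax)
open import Data.Sum using (_⊎_; inj₁; inj₂)
open import Function using (flip; _⇔_; _⤖_; Bijection)
open import Induction.WellFounded using (Acc; acc)
open import Level using (0ℓ)
open import Relation.Binary using (Rel; Decidable; IsStrictPartialOrder)
open import Relation.Binary.Construct.Closure.Transitive
  using (TransClosure; [_]; _∷_; _++_)
open import Relation.Binary.PropositionalEquality
  using (_≡_; _≢_; refl; isEquivalence)
open import Relation.Nullary using (¬_; Dec; yes; no; ¬?; _×-dec_; _⊎-dec_)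
open import Relation.Nullary.Decidable using (map′)
import Relation.Unary as U

record DAG : Set₁ where
  field
    order   : ℕ
  Vertex : Set
  Vertex = Fin order
  field
    Edge    : Rel Vertex 0ℓ
    edge?   : Decidable Edge
    acyclic : ∀ v → ¬ TransClosure Edge v v

  -- Directed paths have length at least one; below, reachability is only
  -- ever considered between distinct vertices.
  Path : Rel Vertex 0ℓ
  Path = TransClosure Edge

  Path-isStrictPartialOrder : IsStrictPartialOrder _≡_ Path
  Path-isStrictPartialOrder = record
    { isEquivalence = isEquivalence
    ; irrefl        = λ { refl → acyclic _ }
    ; trans         = _++_
    ; <-resp-≈      = (λ { refl p → p }) , (λ { refl p → p })
    }

  path? : Decidable Path
  path? u v = go u (spo-noetherian Path-isStrictPartialOrder u)
    where
    FirstStep : Vertex → Set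
    FirstStep x = Edge x v ⊎ ∃[ w ] (Edge x w × Path w v)

    join : ∀ {x} → FirstStep x → Path x v
    join (inj₁ e)           = [ e ]
    join (inj₂ (_ , e , p)) = e ∷ p

    split : ∀ {x} → Path x v → FirstStep x
    split [ e ]   = inj₁ e
    split (e ∷ p) = inj₂ (_ , e , p)

    go : ∀ x → Acc (flip Path) x → Dec (Path x v)
    go x (acc rec) = map′ join split (edge? x v ⊎-dec any? step?)
      where
      step? : ∀ w → Dec (Edge x w × Path w v)
      step? w with edge? x w
      ... | yes e = map′ (e ,_) proj₂ (go w (rec [ e ]))
      ... | no ¬e = no λ q → ¬e (proj₁ q)

open DAG public using (Vertex)

countPairs : ∀ {n} {P : U.Pred (Fin n × Fin n) 0ℓ} → U.Decidable P → ℕ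
countPairs {n} P? = length (filter P? (cartesianProduct (allFin n) (allFin n)))

module _ (G : DAG) where
  open DAG G using (order; Edge; Path; path?)

  -- Positions are 0, …, |V| - 1 instead of 1, …, |V|.
  record TopologicalSorting : Set where
    field
      bijection : Vertex G ⤖ Fin order
    position : Vertex G → Fin order
    position = Bijection.to bijection
    field
      monotone : ∀ {u v} → Edge u v → position u < position v

  open TopologicalSorting using (position)

  record WeakDominanceDrawing : Set where
    field
      t-X t-Y : TopologicalSorting
    X Y : Vertex G → Fin order
    X = position t-X
    Y = position t-Y

  module _ (Γ : WeakDominanceDrawing) where
    open WeakDominanceDrawing Γ using (X; Y)

    FalselyImpliedPath : U.Pred (Vertex G × Vertex G) 0ℓ
    FalselyImpliedPath (u , v) = u ≢ v × X u ≤ X v × Y u ≤ Y v × ¬ Path u v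

    falselyImpliedPath? : U.Decidable FalselyImpliedPath
    falselyImpliedPath? (u , v) =
      ¬? (u ≟ v) ×-dec (X u ≤? X v) ×-dec (Y u ≤? Y v) ×-dec ¬? (path? u v)

    fip : ℕ
    fip = countPairs falselyImpliedPath?

  -- An unordered pair {u , v} of distinct vertices is represented by the
  -- ordered pair with u < v in the numbering of the vertices.
  IncomparablePair : U.Pred (Vertex G × Vertex G) 0ℓ
  IncomparablePair (u , v) = u < v × ¬ Path u v × ¬ Path v u

  incomparablePair? : U.Decidable IncomparablePair
  incomparablePair? (u , v) =
    (u <? v) ×-dec ¬? (path? u v) ×-dec ¬? (path? v u)

  inc : ℕ
  inc = countPairs incomparablePair?

  IsDominanceDrawing : ∀ {k} → (Fin k → TopologicalSorting) → Set
  IsDominanceDrawing t = ∀ u v → u ≢ v →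
    Path u v ⇔ (∀ i → position (t i) u < position (t i) v)

  HasDominanceDrawing : ℕ → Set
  HasDominanceDrawing k = ∃[ t ] IsDominanceDrawing {k} t

IsLeast : U.Pred ℕ 0ℓ → ℕ → Set
IsLeast P m = P m × (∀ k → P k → m ℕ.≤ k)

IsMinFip : DAG → ℕ → Set
IsMinFip G = IsLeast (λ k → ∃[ Γ ] fip G Γ ≡ k)

IsDimension : DAG → ℕ → Set
IsDimension G = IsLeast (λ k → 1 ℕ.≤ k × HasDominanceDrawing G k)

{-# OPTIONS --safe #-}
-- Partition the vertices into chains C₀, …, Cₖ such that C₀ ∪ Cⱼ is not a
-- chain for any j > 0; merging classes greedily produces such a partition.
-- A chain C can be put as high as possible, giving a topological sorting in
-- which every c ∈ C comes after all vertices incomparable to c, and dually as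
-- low as possible.  Putting each of C₀, …, Cₖ high realizes G by k + 1
-- sortings, so dim G ≤ k + 1.  The weak dominance drawing in which X puts C₀
-- high and Y puts C₀ low inverts every incomparable pair meeting C₀; each of
-- C₁, …, Cₖ contributes at least one such pair, so fip ≤ inc G - k.
module Submission where

open import Defs
open import Data.Fin as Fin using (Fin; zero; suc; toℕ; fromℕ<; punchOut; _≟_; _<?_)
open import Data.Fin.Properties as Finₚ
  using (injective⇒≤; punchOut-injective; toℕ-injective; toℕ-fromℕ<; toℕ<n; ¬∀⟶∃¬; all?; any?)
open import Data.Integer using (+_; -_; _-_; _≤_)
import Data.Integer as ℤ
import Data.Integer.Properties as ℤₚ
open import Data.List as List using (List; length; filter; lookup; tabulate; allFin; cartesianProduct)
open import Data.List.Membership.Propositional using (_∈_; lose)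
open import Data.List.Membership.Propositional.Properties
open import Data.List.Membership.Setoid.Properties using (index-injective)
open import Data.List.Properties using (filter-notAll; length-++; length-tabulate)
open import Data.List.Relation.Unary.All as All using (_∷_)
open import Data.List.Relation.Unary.AllPairs using (_∷_)
open import Data.List.Relation.Unary.Any using (here; there; index)
open import Data.List.Relation.Unary.Unique.Propositional using (Unique)
import Data.List.Relation.Unary.Unique.Propositional.Properties as Unique
open import Data.Nat as ℕ using (ℕ; z≤n; s≤s)
import Data.Nat.Properties as ℕₚ
open import Data.Product using (_×_; _,_; proj₁; proj₂; ∃₂; ∃-syntax; swap)
open import Data.Sum as Sum using (_⊎_; inj₁; inj₂)
open import Function using (_∘_; id; mk⇔; Injective; mk⤖; Bijection)
open import Level using (Level; 0ℓ)
open import Relation.Binary using (IsPartialOrder; Rel; tri<; tri≈; tri>)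
import Relation.Binary.Construct.StrictToNonStrict as StrictToNonStrict
open import Relation.Binary.Construct.Closure.Transitive using ([_]; _∷_)
open import Relation.Binary.PropositionalEquality
open import Relation.Nullary using (¬_; Dec; yes; no; ¬?; _×-dec_; _⊎-dec_; contradiction)
open import Relation.Nullary.Decidable using (decidable-stable)
import Relation.Unary as U

private variable
  a b p : Level
  A : Set a
  B : Set b
  n : ℕ

-- Counting duplicate-free lists and finite subsets.

lookup-injective : {xs : List A} → Unique xs → Injective _≡_ _≡_ (lookup xs)
lookup-injective (_ ∷ _) {zero}  {zero}  _  = refl
lookup-injective (x∉ ∷ _) {zero}  {suc j} eq = contradiction eq (All.lookup x∉ (∈-lookup j))
lookup-injective (x∉ ∷ _) {suc i} {zero}  eq = contradiction (sym eq) (All.lookup x∉ (∈-lookup i))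
lookup-injective (_ ∷ u) {suc i} {suc j} eq = cong suc (lookup-injective u eq)

-- Injectivity is asked only on members of `xs`, because `orient`, later used as `f`, identifies
-- every pair with its swap.
length-≤-of-injection : {xs : List A} {ys : List B} (f : A → B) → Unique xs →
  (∀ {x} → x ∈ xs → f x ∈ ys) →
  (∀ {x x′} → x ∈ xs → x′ ∈ xs → f x ≡ f x′ → x ≡ x′) →
  length xs ℕ.≤ length ys
length-≤-of-injection f u f∈ inj =
  injective⇒≤ {f = λ i → index (f∈ (∈-lookup i))} λ {i} {j} eq →
    lookup-injective u (inj (∈-lookup i) (∈-lookup j)
      (index-injective (setoid _) (f∈ (∈-lookup i)) (f∈ (∈-lookup j)) eq))

-- A missed value `y` could be punched out of the codomain, leaving an injection from `Fin (suc n)`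
-- into `Fin n`.
injective⇒surjective : {f : Fin n → Fin n} → Injective _≡_ _≡_ f → ∀ y → ∃[ x ] f x ≡ y
injective⇒surjective {n = ℕ.suc n} {f} inj y with any? (λ x → f x ≟ y)
... | yes hit = hit
... | no  miss = contradiction (injective⇒≤ punch-injective) ℕₚ.1+n≰n
  where
  y≢f : ∀ x → y ≢ f x
  y≢f x eq = miss (x , sym eq)

  punch-injective : Injective _≡_ _≡_ (λ x → punchOut (y≢f x))
  punch-injective {i} {j} = inj ∘ punchOut-injective (y≢f i) (y≢f j)

count : {P : U.Pred (Fin n) p} → U.Decidable P → ℕ
count {n} P? = length (filter P? (allFin n))

module _ {P : U.Pred (Fin n) p} (P? : U.Decidable P) where

  count-< : ∀ {x} → ¬ P x → count P? ℕ.< n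
  count-< {x} ¬Px = subst (count P? ℕ.<_) (length-tabulate id)
    (filter-notAll P? (allFin n) (lose (∈-allFin x) ¬Px))

  module _ {Q : U.Pred (Fin n) p} (Q? : U.Decidable Q) (P⊆Q : ∀ {x} → P x → Q x) where

    private
      sub : ∀ {x} → x ∈ filter P? (allFin n) → x ∈ filter Q? (allFin n)
      sub = ∈-filter⁺ Q? (∈-allFin _) ∘ P⊆Q ∘ proj₂ ∘ ∈-filter⁻ P? {xs = allFin n}

    count-mono-≤ : count P? ℕ.≤ count Q?
    count-mono-≤ = length-≤-of-injection id (Unique.filter⁺ P? (Unique.allFin⁺ n)) sub (λ _ _ → id)

    -- Adding `x` to the elements counted by `P?` creates no duplicate and stays within those
    -- counted by `Q?`.
    count-mono-< : ∀ {x} → ¬ P x → Q x → count P? ℕ.< count Q?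
    count-mono-< {x} ¬Px Qx = length-≤-of-injection id
      (All.tabulate (λ y∈ x≡y → ¬Px (subst P (sym x≡y) (proj₂ (∈-filter⁻ P? {xs = allFin n} y∈))))
        ∷ Unique.filter⁺ P? (Unique.allFin⁺ n))
      (λ { (here refl) → ∈-filter⁺ Q? (∈-allFin _) Qx ; (there y∈) → sub y∈ })
      (λ _ _ → id)

-- Unordered pairs and their representatives.

orient : Fin n × Fin n → Fin n × Fin n
orient (u , v) with u <? v
... | yes _ = u , v
... | no  _ = v , u

orient-cases : (e : Fin n × Fin n) → orient e ≡ e ⊎ orient e ≡ swap e
orient-cases (u , v) with u <? v
... | yes _ = inj₁ refl
... | no  _ = inj₂ refl

orient-≡ : (e f : Fin n × Fin n) → orient e ≡ orient f → e ≡ f ⊎ e ≡ swap f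
orient-≡ e f eq with orient-cases e | orient-cases f
... | inj₁ p | inj₁ q = inj₁ (trans (sym p) (trans eq q))
... | inj₁ p | inj₂ q = inj₂ (trans (sym p) (trans eq q))
... | inj₂ p | inj₁ q = inj₂ (cong swap (trans (sym p) (trans eq q)))
... | inj₂ p | inj₂ q = inj₁ (cong swap (trans (sym p) (trans eq q)))

-- Passage to integer subtraction.

≤-minus-2 : ∀ {m d i} → ∃[ k ] d ℕ.≤ ℕ.suc k × m ℕ.+ k ℕ.≤ i → + m ≤ + i - (+ d - + 2)
≤-minus-2 {m} {d} {i} (k , d≤1+k , m+k≤i) = begin
  + m               ≤⟨ ℤ.+≤+ (ℕₚ.m+n≤o⇒m≤o∸n m m+k≤i) ⟩
  + (i ℕ.∸ k)       ≡⟨ ℤₚ.⊖-≥ (ℕₚ.m+n≤o⇒n≤o m m+k≤i) ⟨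
  i ℤ.⊖ k           ≡⟨ ℤₚ.m-n≡m⊖n i k ⟨
  + i - + k         ≤⟨ ℤₚ.+-monoʳ-≤ (+ i) (ℤₚ.neg-mono-≤ d-2≤k) ⟩
  + i - (+ d - + 2) ∎
  where
  open ℤₚ.≤-Reasoning

  d-2≤k : + d - + 2 ≤ + k
  d-2≤k = begin
    + d - + 2         ≤⟨ ℤₚ.+-monoˡ-≤ (- + 2) (ℤ.+≤+ d≤1+k) ⟩
    + ℕ.suc k - + 2   ≡⟨ ℤₚ.[1+m]⊖[1+n]≡m⊖n k 1 ⟩
    -- One unit is given away here: the premise `d ≤ 1 + k` yields even `d - 1 ≤ k`.
    k ℤ.⊖ 1           ≤⟨ ℤₚ.m⊖n≤m k 1 ⟩
    + k               ∎

-- Comparability of vertices.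

module _ (G : DAG) where
  open DAG G using (order; Path; path?; Path-isStrictPartialOrder)
  open TopologicalSorting using (position; bijection; monotone)

  open StrictToNonStrict _≡_ Path using () renaming (_≤_ to _≼_)
  open IsPartialOrder (StrictToNonStrict.isPartialOrder _≡_ Path Path-isStrictPartialOrder)
    using () renaming (refl to ≼-refl; trans to ≼-trans)

  _≼?_ : (u v : Vertex G) → Dec (u ≼ v)
  _≼?_ = StrictToNonStrict.decidable _≡_ Path _≟_ path?

  Comparable : Rel (Vertex G) 0ℓ
  Comparable u v = u ≼ v ⊎ v ≼ u

  comparable? : (u v : Vertex G) → Dec (Comparable u v)
  comparable? u v = (u ≼? v) ⊎-dec (v ≼? u)

  position-injective : (t : TopologicalSorting G) → Injective _≡_ _≡_ (position t)
  position-injective t = Bijection.injective (bijection t)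

  position-path : (t : TopologicalSorting G) → ∀ {u v} → Path u v → position t u Fin.< position t v
  position-path t [ e ]   = monotone t e
  position-path t (e ∷ p) = ℕₚ.<-trans (monotone t e) (position-path t p)

  -- Topological sortings from monotone heights.

  module SortByHeight (t : TopologicalSorting G) (height : Vertex G → ℕ)
    (height-mono : ∀ {u v} → u ≼ v → height u ℕ.≤ height v) where

    private
      -- The pair (height u , position u), compared lexicographically.
      key : Vertex G → ℕ
      key u = height u ℕ.* order ℕ.+ toℕ (position t u)

      key-height-< : ∀ {u v} → height u ℕ.< height v → key u ℕ.< key v
      key-height-< {u} {v} hu<hv = begin-strict
        -- Positions stay below `order`, so they never outweigh one unit of height.
        height u ℕ.* order ℕ.+ toℕ (position t u) <⟨ ℕₚ.+-monoʳ-< (height u ℕ.* order) (toℕ<n (position t u)) ⟩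
        height u ℕ.* order ℕ.+ order              ≡⟨ ℕₚ.+-comm (height u ℕ.* order) order ⟩
        ℕ.suc (height u) ℕ.* order                ≤⟨ ℕₚ.*-monoˡ-≤ order hu<hv ⟩
        height v ℕ.* order                        ≤⟨ ℕₚ.m≤m+n _ _ ⟩
        key v                                     ∎
        where open ℕₚ.≤-Reasoning

      -- A path need not raise the height, but it always raises the position in `t`, which breaks
      -- ties.
      key-path-< : ∀ {u v} → Path u v → key u ℕ.< key v
      key-path-< p = ℕₚ.+-mono-≤-< (ℕₚ.*-monoˡ-≤ order (height-mono (inj₁ p))) (position-path t p)

      key-injective : ∀ {u v} → key u ≡ key v → u ≡ v
      key-injective {u} {v} eq with ℕₚ.<-cmp (height u) (height v)
      ... | tri< lt _ _ = contradiction eq (ℕₚ.<⇒≢ (key-height-< lt))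
      ... | tri> _ _ gt = contradiction (sym eq) (ℕₚ.<⇒≢ (key-height-< gt))
      ... | tri≈ _ hu≡hv _ = position-injective t (toℕ-injective (ℕₚ.+-cancelˡ-≡ (height v ℕ.* order) _ _
              (trans (cong (λ h → h ℕ.* order ℕ.+ toℕ (position t u)) (sym hu≡hv)) eq)))

      before? : ∀ u → U.Decidable (λ w → key w ℕ.< key u)
      before? u w = key w ℕₚ.<? key u

      -- Compresses the keys to consecutive positions while keeping their order.
      rank : Vertex G → Fin order
      rank u = fromℕ< (count-< (before? u) {u} (ℕₚ.<-irrefl refl))

      rank-< : ∀ {u v} → key u ℕ.< key v → rank u Fin.< rank v
      rank-< {u} {v} lt = subst₂ ℕ._<_ (sym (toℕ-fromℕ< _)) (sym (toℕ-fromℕ< _))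
        (count-mono-< (before? u) (before? v) (λ w<u → ℕₚ.<-trans w<u lt) {u} (ℕₚ.<-irrefl refl) lt)

      rank-injective : Injective _≡_ _≡_ rank
      rank-injective {u} {v} eq with ℕₚ.<-cmp (key u) (key v)
      ... | tri< lt _ _ = contradiction eq (Finₚ.<⇒≢ (rank-< lt))
      ... | tri≈ _ k≡ _ = key-injective k≡
      ... | tri> _ _ gt = contradiction (sym eq) (Finₚ.<⇒≢ (rank-< gt))

      rank-surjective : ∀ y → ∃[ x ] ∀ {z} → z ≡ x → rank z ≡ y
      rank-surjective y with x , eq ← injective⇒surjective rank-injective y = x , λ { refl → eq }

    sorting : TopologicalSorting G
    sorting = record
      { bijection = mk⤖ (rank-injective , rank-surjective)
      ; monotone  = λ e → rank-< (key-path-< [ e ])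
      }

    position-height-< : ∀ {u v} → height u ℕ.< height v → position sorting u Fin.< position sorting v
    position-height-< = rank-< ∘ key-height-<

  -- Sorting a chain as high or as low as possible.

  module ExtremalSortings (t : TopologicalSorting G) {C : U.Pred (Vertex G) 0ℓ} (C? : U.Decidable C)
    (chain : ∀ {c d} → C c → C d → Comparable c d) where

    private
      below? : ∀ u → U.Decidable (λ c → C c × c ≼ u)
      below? u c = C? c ×-dec (c ≼? u)

      -- Counting the chain elements not above `u`, rather than those above, makes the height grow
      -- along paths.
      notAbove? : ∀ u → U.Decidable (λ c → C c × ¬ u ≼ c)
      notAbove? u c = C? c ×-dec ¬? (u ≼? c)

      module High = SortByHeight t (λ u → count (below? u))
        (λ {u} {v} u≼v → count-mono-≤ (below? u) (below? v) λ (Cc , c≼u) → Cc , ≼-trans c≼u u≼v)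

      module Low = SortByHeight t (λ u → count (notAbove? u))
        (λ {u} {v} u≼v → count-mono-≤ (notAbove? u) (notAbove? v) λ (Cc , u⋠c) → Cc , u⋠c ∘ ≼-trans u≼v)

    high low : TopologicalSorting G
    high = High.sorting
    low  = Low.sorting

    -- A chain element below `u` is also below `c`, as otherwise `c` would lie below it and hence
    -- below `u`. Moreover `c` is counted for itself but not for `u`.
    high-> : ∀ {c u} → C c → ¬ Comparable c u → position high u Fin.< position high c
    high-> {c} {u} Cc c∥u = High.position-height-< (count-mono-< (below? u) (below? c)
      (λ (Cd , d≼u) → Cd , Sum.[ (λ c≼d → contradiction (inj₁ (≼-trans c≼d d≼u)) c∥u) , id ] (chain Cc Cd))
      {c} (c∥u ∘ inj₁ ∘ proj₂) (Cc , ≼-refl))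

    -- A chain element not above `c` lies below `c`, so it cannot be above `u` without making `u`
    -- and `c` comparable. Moreover `c` is counted for `u` but not for itself.
    low-< : ∀ {c u} → C c → ¬ Comparable c u → position low c Fin.< position low u
    low-< {c} {u} Cc c∥u = Low.position-height-< (count-mono-< (notAbove? c) (notAbove? u)
      (λ {d} (Cd , c⋠d) → Cd , λ u≼d →
        Sum.[ c⋠d , (λ d≼c → c∥u (inj₂ (≼-trans u≼d d≼c))) ] (chain Cc Cd))
      {c} (λ (_ , c⋠c) → c⋠c ≼-refl) (Cc , c∥u ∘ inj₂))

  -- Chain colourings.

  ChainColouring : ∀ {k} → (Vertex G → Fin k) → Set
  ChainColouring colour = ∀ {u v} → colour u ≡ colour v → Comparable u v

  module _ {k} {colour : Vertex G → Fin (ℕ.suc k)} (chain : ChainColouring colour)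
    (t : TopologicalSorting G) where

    module Class (i : Fin (ℕ.suc k)) =
      ExtremalSortings t (λ v → colour v ≟ i) (λ c∈i d∈i → chain (trans c∈i (sym d∈i)))

    -- If `u` and `v` are incomparable, the sorting that raises the class of `u` puts `v` before
    -- `u`; if `v` reaches `u`, every sorting does.
    colouring⇒dominanceDrawing : HasDominanceDrawing G (ℕ.suc k)
    colouring⇒dominanceDrawing = Class.high , λ u v u≢v →
      mk⇔ (λ p i → position-path (Class.high i) p) (realize u≢v)
      where
      realize : ∀ {u v} → u ≢ v →
        (∀ i → position (Class.high i) u Fin.< position (Class.high i) v) → Path u v
      realize {u} {v} u≢v u<v with comparable? u v
      ... | yes (inj₁ (inj₁ p)) = p
      ... | yes (inj₁ (inj₂ u≡v)) = contradiction u≡v u≢v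
      ... | yes (inj₂ (inj₂ v≡u)) = contradiction (sym v≡u) u≢v
      ... | yes (inj₂ (inj₁ p)) = contradiction (position-path (Class.high zero) p) (ℕₚ.<-asym (u<v zero))
      ... | no u∥v = contradiction (Class.high-> (colour u) refl u∥v) (ℕₚ.<-asym (u<v (colour u)))

  -- Positive form of "the union of the two classes is not a chain"; the witnesses later serve as
  -- the inverted pairs.
  Clash₀ : ∀ {k} → (Vertex G → Fin (ℕ.suc k)) → Fin k → Set
  Clash₀ colour j = ∃₂ λ u v → colour u ≡ zero × colour v ≡ suc j × ¬ Comparable u v

  clash₀? : ∀ {k} (colour : Vertex G → Fin (ℕ.suc k)) → U.Decidable (Clash₀ colour)
  clash₀? colour j = any? λ u → any? λ v →
    (colour u ≟ zero) ×-dec (colour v ≟ suc j) ×-dec ¬? (comparable? u v)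

  MaximalClass₀ : ∀ {k} → (Vertex G → Fin (ℕ.suc k)) → Set
  MaximalClass₀ colour = ∀ j → Clash₀ colour j

  module _ {k} (j : Fin (ℕ.suc k)) where

    -- Moves class `suc j` into class `zero`; `punchOut` closes the gap in the numbering and fixes
    -- `zero`.
    merge : Fin (ℕ.suc (ℕ.suc k)) → Fin (ℕ.suc k)
    merge i with suc j ≟ i
    ... | yes _ = zero
    ... | no j≢i = punchOut j≢i

    merge-≡ : ∀ i i′ → merge i ≡ merge i′ →
      i ≡ i′ ⊎ (i ≡ zero × i′ ≡ suc j) ⊎ (i ≡ suc j × i′ ≡ zero)
    merge-≡ i i′ eq with suc j ≟ i | suc j ≟ i′
    ... | yes p | yes q = inj₁ (trans (sym p) q)
    -- As `punchOut` fixes `zero`, `eq` equates two values of `punchOut`, and injectivity gives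
    -- `i′ ≡ zero`.
    ... | yes p | no  q = inj₂ (inj₂ (sym p , sym (punchOut-injective {j = zero} (λ ()) q eq)))
    ... | no  p | yes q = inj₂ (inj₁ (punchOut-injective {k = zero} p (λ ()) eq , sym q))
    ... | no  p | no  q = inj₁ (punchOut-injective p q eq)

  -- A class that does not clash with class zero forms a chain with it, by decidability of
  -- comparability. Merging the two uses up one colour, and with a single colour left the condition
  -- is vacuous.
  chainColouring-maximalClass₀ : ∀ {k} {colour : Vertex G → Fin (ℕ.suc k)} → ChainColouring colour →
    ∃₂ λ l (colour′ : Vertex G → Fin (ℕ.suc l)) → ChainColouring colour′ × MaximalClass₀ colour′
  chainColouring-maximalClass₀ {ℕ.zero} {colour} chain = ℕ.zero , colour , chain , λ ()
  chainColouring-maximalClass₀ {ℕ.suc k} {colour} chain with all? (clash₀? colour)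
  ... | yes maximal = ℕ.suc k , colour , chain , maximal
  ... | no ¬maximal with j , ¬clash ← ¬∀⟶∃¬ _ _ (clash₀? colour) ¬maximal =
    chainColouring-maximalClass₀ {colour = merge j ∘ colour} merged
    where
    merged : ChainColouring (merge j ∘ colour)
    merged {u} {v} eq with merge-≡ j (colour u) (colour v) eq
    ... | inj₁ same = chain same
    ... | inj₂ (inj₁ (u₀ , vⱼ)) = decidable-stable (comparable? u v) λ u∥v → ¬clash (u , v , u₀ , vⱼ , u∥v)
    ... | inj₂ (inj₂ (uⱼ , v₀)) =
      Sum.swap (decidable-stable (comparable? v u) λ v∥u → ¬clash (v , u , v₀ , uⱼ , v∥u))

  -- Falsely implied and inverted pairs among the incomparable ones.

  module _ (Γ : WeakDominanceDrawing G) where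
    open WeakDominanceDrawing Γ

    Inverted : U.Pred (Vertex G × Vertex G) 0ℓ
    Inverted (u , v) = X v Fin.< X u × Y u Fin.< Y v

    private
      -- `Y` selects exactly one of the two orders of an incomparable pair, so `orient` is injective
      -- on these pairs.
      IncomparableRising : U.Pred (Vertex G × Vertex G) 0ℓ
      IncomparableRising (u , v) = Y u Fin.< Y v × ¬ Path u v × ¬ Path v u

      fip⇒ : ∀ {e} → FalselyImpliedPath G Γ e → IncomparableRising e
      fip⇒ (u≢v , _ , Yu≤Yv , ¬p) = Yu<Yv , ¬p , λ p → ℕₚ.<-asym Yu<Yv (position-path t-Y p)
        where Yu<Yv = Finₚ.≤∧≢⇒< Yu≤Yv (u≢v ∘ position-injective t-Y)

      inverted⇒ : ∀ {e} → Inverted e → IncomparableRising e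
      inverted⇒ (Xv<Xu , Yu<Yv) = Yu<Yv ,
        (λ p → ℕₚ.<-asym Xv<Xu (position-path t-X p)) , λ p → ℕₚ.<-asym Yu<Yv (position-path t-Y p)

      orient-incomparable : ∀ {e} → IncomparableRising e → IncomparablePair G (orient e)
      orient-incomparable {u , v} (Yu<Yv , ¬p , ¬q) with u <? v
      ... | yes u<v = u<v , ¬p , ¬q
      ... | no  u≮v = Finₚ.≤∧≢⇒< (ℕₚ.≮⇒≥ u≮v) (λ { refl → ℕₚ.<-irrefl refl Yu<Yv }) , ¬q , ¬p

      orient-injective : ∀ {e f} → IncomparableRising e → IncomparableRising f → orient e ≡ orient f → e ≡ f
      orient-injective {e} {f} (Ye , _) (Yf , _) eq with orient-≡ e f eq
      ... | inj₁ e≡f = e≡f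
      ... | inj₂ refl = contradiction Yf (ℕₚ.<-asym Ye)

      pairs : List (Vertex G × Vertex G)
      pairs = cartesianProduct (allFin order) (allFin order)

      ∈-pairs : ∀ e → e ∈ pairs
      ∈-pairs (u , v) = ∈-cartesianProduct⁺ (∈-allFin u) (∈-allFin v)

      pairs-unique : Unique pairs
      pairs-unique = Unique.cartesianProduct⁺ (Unique.allFin⁺ order) (Unique.allFin⁺ order)

    -- `X` rises along falsely implied paths and falls along the pairs `w j`, so the two lists are
    -- disjoint; `orient` embeds their concatenation into the incomparable pairs.
    fip+inverted≤inc : ∀ {k} (w : Fin k → Vertex G × Vertex G) → Injective _≡_ _≡_ w →
      (∀ j → Inverted (w j)) → fip G Γ ℕ.+ k ℕ.≤ inc G
    fip+inverted≤inc {k} w w-injective w-inverted = subst (ℕ._≤ inc G)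
      (trans (length-++ fips) (cong (fip G Γ ℕ.+_) (length-tabulate w)))
      (length-≤-of-injection orient unique
        (λ e∈ → ∈-filter⁺ (incomparablePair? G) (∈-pairs _) (orient-incomparable (rising e∈)))
        (λ e∈ f∈ → orient-injective (rising e∈) (rising f∈)))
      where
      fips = filter (falselyImpliedPath? G Γ) pairs

      fips⇒ : ∀ {e} → e ∈ fips → FalselyImpliedPath G Γ e
      fips⇒ = proj₂ ∘ ∈-filter⁻ (falselyImpliedPath? G Γ) {xs = pairs}

      w⇒ : ∀ {e} → e ∈ tabulate w → Inverted e
      w⇒ e∈ with j , refl ← ∈-tabulate⁻ e∈ = w-inverted j

      unique : Unique (fips List.++ tabulate w)
      unique = Unique.++⁺ (Unique.filter⁺ (falselyImpliedPath? G Γ) pairs-unique) (Unique.tabulate⁺ w-injective)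
        λ (e∈fips , e∈w) → ℕₚ.<⇒≱ (proj₁ (w⇒ e∈w)) (proj₁ (proj₂ (fips⇒ e∈fips)))

      rising : ∀ {e} → e ∈ fips List.++ tabulate w → IncomparableRising e
      rising e∈ = Sum.[ fip⇒ ∘ fips⇒ , inverted⇒ ∘ w⇒ ] (∈-++⁻ fips e∈)

  -- The bound obtained from a maximal class zero.

  maximalClass₀⇒drawing : ∀ {k} {colour : Vertex G → Fin (ℕ.suc k)} →
    ChainColouring colour → MaximalClass₀ colour → TopologicalSorting G →
    ∃[ Γ ] fip G Γ ℕ.+ k ℕ.≤ inc G
  maximalClass₀⇒drawing {k} {colour} chain maximal t = Γ , fip+inverted≤inc Γ w w-injective w-inverted
    where
    open Class chain t zero

    Γ : WeakDominanceDrawing G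
    Γ = record { t-X = high ; t-Y = low }

    w : Fin k → Vertex G × Vertex G
    w j with u , v , _ ← maximal j = u , v

    w-colour : ∀ j → colour (proj₂ (w j)) ≡ suc j
    w-colour j with _ , _ , _ , v≡j , _ ← maximal j = v≡j

    -- First components of clashes may coincide; the colours of the second ones tell the clashes
    -- apart.
    w-injective : Injective _≡_ _≡_ w
    w-injective {i} {j} eq = Finₚ.suc-injective
      (trans (sym (w-colour i)) (trans (cong (colour ∘ proj₂) eq) (w-colour j)))

    w-inverted : ∀ j → Inverted Γ (w j)
    w-inverted j with _ , _ , u≡0 , _ , u∥v ← maximal j = high-> u≡0 u∥v , low-< u≡0 u∥v

  minFip+k≤inc : ∀ {minFip k} → IsMinFip G minFip → ∃[ Γ ] fip G Γ ℕ.+ k ℕ.≤ inc G →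
    minFip ℕ.+ k ℕ.≤ inc G
  minFip+k≤inc {k = k} (_ , least) (Γ , fip+k≤inc) =
    ℕₚ.≤-trans (ℕₚ.+-monoˡ-≤ k (least (fip G Γ) (Γ , refl))) fip+k≤inc

  minFip+dim-bound : ∀ {minFip dim} → IsMinFip G minFip → IsDimension G dim →
    ∃[ k ] dim ℕ.≤ ℕ.suc k × minFip ℕ.+ k ℕ.≤ inc G
  minFip+dim-bound {minFip} {dim} isMinFip@((Γ₀ , _) , _) (_ , dim-least) =
    -- Class zero starts empty and every vertex is alone in its class; this also covers the graph
    -- without vertices.
    bound (chainColouring-maximalClass₀ {colour = suc} (λ { refl → inj₁ ≼-refl }))
    where
    -- A drawing attaining the minimum already supplies a topological sorting.
    t = WeakDominanceDrawing.t-X Γ₀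

    bound : (∃₂ λ k (colour : Vertex G → Fin (ℕ.suc k)) → ChainColouring colour × MaximalClass₀ colour) →
      ∃[ k ] dim ℕ.≤ ℕ.suc k × minFip ℕ.+ k ℕ.≤ inc G
    bound (k , colour , chain , maximal) =
      k ,
      dim-least (ℕ.suc k) (s≤s z≤n , colouring⇒dominanceDrawing {colour = colour} chain t) ,
      minFip+k≤inc isMinFip (maximalClass₀⇒drawing {colour = colour} chain maximal t)

lemma1 : (G : DAG) (minFip dim : ℕ) →
    IsMinFip G minFip → IsDimension G dim →
    + minFip ≤ + inc G - (+ dim - + 2)
lemma1 G minFip dim isMinFip isDimension = ≤-minus-2 (minFip+dim-bound G isMinFip isDimension)
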